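{- For every $d\ge 3$ there is a constant $c=c(d)$ such that for all $n$, $OT_d(n)\le \mathrm{twr}_d(n^c)$.
   Context: The tower function is defined by $\mathrm{twr}_1(x)=x$ and $\mathrm{twr}_{i+1}(x)=2^{\mathrm{twr}_i(x)}$. A point set in $\mathbb{R}^d$ is in general position if no $d+1$ of its points lie on a common hyperplane. For an ordered point set $P=\{p_1,\dots,p_N\}\subset\mathbb{R}^d$ and indices $i_1<\dots<i_{d+1}$, let $M$ be the $(d+1)\times(d+1)$ matrix whose $j$-th column is $(1,p_{i_j})$ (a $1$ followed by the $d$ coordinates of $p_{i_j}$); the tuple $(p_{i_1},\dots,p_{i_{d+1}})$ has positive orientation if $\det M>0$ and negative orientation if $\det M<0$. $OT_d(n)$ is the smallest integer $N$ such that any (ordered) set of $N$ points in general position in $\mathbb{R}^d$ contains $n$ members such that every $(d+1)$-tuple of them (in increasing index order) has the same orientation. -}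

module Defs where

open import Level using (Level; _⊔_) renaming (suc to lsuc)
open import Data.Nat using (ℕ; zero; suc; _^_; _≤_; _<_)
open import Data.Fin using (Fin; zero; suc; punchIn) renaming (_<_ to _<ᶠ_)
open import Data.Product using (Σ; ∃; _×_; _,_)
open import Data.Sum using (_⊎_)
open import Relation.Nullary using (¬_)
open import Algebra.Bundles using (CommutativeRing)

-- Tower function: twr 1 x = x, twr (i+1) x = 2 ^ twr i x.
-- (twr 0 x = x is an irrelevant extra convention; only i ≥ 1 is used.)

twr : ℕ → ℕ → ℕ
twr zero x = x
twr (suc zero) x = x
twr (suc (suc i)) x = 2 ^ twr (suc i) x

-- Ordered fields.  ℝ is the intended instance; we quantify over every
-- ordered field.

record OrderedField (a ℓ : Level) : Set (lsuc (a ⊔ ℓ)) where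
  field
    commRing : CommutativeRing a ℓ
  open CommutativeRing commRing public
    using (Carrier; _≈_; _+_; _*_; -_; 0#; 1#)
  field
    _<ᶠ′_      : Carrier → Carrier → Set ℓ
    <-resp-≈   : ∀ {x x′ y y′} → x ≈ x′ → y ≈ y′ → x <ᶠ′ y → x′ <ᶠ′ y′
    <-irrefl   : ∀ {x} → ¬ (x <ᶠ′ x)
    <-trans    : ∀ {x y z} → x <ᶠ′ y → y <ᶠ′ z → x <ᶠ′ z
    <-trichot  : ∀ x y → x <ᶠ′ y ⊎ (x ≈ y ⊎ y <ᶠ′ x)
    +-mono-<   : ∀ {x y} z → x <ᶠ′ y → (x + z) <ᶠ′ (y + z)
    *-pos      : ∀ {x y} → 0# <ᶠ′ x → 0# <ᶠ′ y → 0# <ᶠ′ (x * y)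
    0<1        : 0# <ᶠ′ 1#
    inverse    : ∀ x → ¬ (x ≈ 0#) → ∃ λ y → (x * y) ≈ 1#

module _ {a ℓ} (F : OrderedField a ℓ) where
  open OrderedField F
    using (Carrier; _≈_; _+_; _*_; -_; 0#; 1#; _<ᶠ′_)

  Σᶠ : ∀ n → (Fin n → Carrier) → Carrier
  Σᶠ zero f = 0#
  Σᶠ (suc n) f = f zero + Σᶠ n (λ j → f (suc j))

  altSign : ∀ {n} → Fin n → Carrier
  altSign zero = 1#
  altSign (suc j) = - altSign j

  det : ∀ n → (Fin n → Fin n → Carrier) → Carrier
  det zero M = 1#
  det (suc n) M =
    Σᶠ (suc n) λ j → (altSign j * M zero j) * det n (λ i k → M (suc i) (punchIn j k))

  Point : ℕ → Set a
  Point d = Fin d → Carrier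

  orientMatrix : ∀ d → (Fin (suc d) → Point d) → Fin (suc d) → Fin (suc d) → Carrier
  orientMatrix d q zero    j = 1#
  orientMatrix d q (suc i) j = q j i

  StrictlyIncreasing : ∀ {m n} → (Fin m → Fin n) → Set
  StrictlyIncreasing f = ∀ {i j} → i <ᶠ j → f i <ᶠ f j

  tuple : ∀ {d N} → (Fin N → Point d) → (Fin (suc d) → Fin N) → Fin (suc d) → Point d
  tuple P g j = P (g j)

  orientDet : ∀ {d N} → (Fin N → Point d) → (Fin (suc d) → Fin N) → Carrier
  orientDet {d} P g = det (suc d) (orientMatrix d (tuple P g))

  PositiveOrientation NegativeOrientation :
    ∀ {d N} → (Fin N → Point d) → (Fin (suc d) → Fin N) → Set ℓ
  PositiveOrientation P g = 0# <ᶠ′ orientDet P g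
  NegativeOrientation P g = orientDet P g <ᶠ′ 0#

  -- general position: no d+1 points lie on a common hyperplane,
  -- i.e. every (d+1)-tuple (increasing indices) has nonzero orientation determinant
  GeneralPosition : ∀ {d N} → (Fin N → Point d) → Set ℓ
  GeneralPosition {d} {N} P =
    ∀ (g : Fin (suc d) → Fin N) → StrictlyIncreasing g → ¬ (orientDet P g ≈ 0#)

  HasMonotoneSubset : ∀ {d N} → ℕ → (Fin N → Point d) → Set ℓ
  HasMonotoneSubset {d} {N} n P =
    Σ (Fin n → Fin N) λ f → StrictlyIncreasing f ×
      ((∀ (g : Fin (suc d) → Fin n) → StrictlyIncreasing g →
          PositiveOrientation P (λ j → f (g j)))
       ⊎ (∀ (g : Fin (suc d) → Fin n) → StrictlyIncreasing g →
          NegativeOrientation P (λ j → f (g j))))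

  OTProperty : ℕ → ℕ → ℕ → Set (a ⊔ ℓ)
  OTProperty d n N =
    ∀ (P : Fin N → Point d) → GeneralPosition P → HasMonotoneSubset n P

  -- OT_d(n) ≤ T  (OT_d(n) is the least N with OTProperty d n N)
  OT≤ : ℕ → ℕ → ℕ → Set (a ⊔ ℓ)
  OT≤ d n T = Σ ℕ λ N → N ≤ T × OTProperty d n N

{-# OPTIONS --safe #-}

-- The sign of [q₁,…,q_{d-1},i,j], for fixed q's, is a 2-colouring of pairs with polynomial Ramsey
-- numbers: by the three-term Plücker relation, "[Q,i,j] > 0" is transitive on any set of points i for
-- which [Q,r,i] has constant sign, so patience sorting finds a large homogeneous subset.  Each
-- Erdős–Rado step, which makes the orientation independent of the first point of a tuple and then fixes
-- that point as the next q, costs one exponential.  The d - 1 steps from uniformity 2 to d + 1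
-- turn n^O(1) into twr_d(n^O(1)).

module Submission where

open import Defs
open import Level using (Level)
open import Data.Nat using (ℕ; _^_; _≤_)
open import Data.Product using (Σ)

open import Algebra.Bundles using (CommutativeRing)
import Algebra.Properties.CommutativeSemigroup
import Algebra.Properties.Ring
open import Data.Bool using (Bool; true; false)
open import Data.Empty using (⊥-elim)
open import Data.Fin using (Fin; zero; suc; punchIn) renaming (_<_ to _<ᶠ_)
open import Data.List using (List; []; _∷_; [_]; _++_; _ʳ++_; tabulate)
open import Data.List.Membership.Propositional using (_∈_; find)
open import Data.List.Relation.Unary.Any using (here; there; any?)
open import Data.Nat using (zero; suc)
open import Data.Sum using (_⊎_; inj₁; inj₂)
open import Function using (_∘_; id)
import Relation.Binary.PropositionalEquality as ≡
import Relation.Binary.Reasoning.Setoid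
open import Relation.Nullary using (¬_; yes; no)

-- Exterior algebra over an index set, up to the three-term Plücker relation.

module Wedge {a ℓ} (R : CommutativeRing a ℓ) {x} (X : Set x) where
  open CommutativeRing R
  open Algebra.Properties.Ring ring
  open Algebra.Properties.CommutativeSemigroup +-commutativeSemigroup using (interchange)
  open Algebra.Properties.CommutativeSemigroup *-commutativeSemigroup using (x∙yz≈y∙xz)
  open Relation.Binary.Reasoning.Setoid setoid

  -- `X` is a bare index set, and a form is known by its values on lists of every length.
  -- Contraction with `x` is then precomposition with `x ∷_`, and degrees need no tracking.
  Form : Set _
  Form = List X → Carrier

  -- Exterior product with a functional: contracting with x is the antiderivation
  -- ι_x (φ ∧ ω) = φ(x) ω − φ ∧ ι_x ω.
  infixr 7 _∧_
  _∧_ : (X → Carrier) → Form → Form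
  (φ ∧ ω) []       = 0#
  (φ ∧ ω) (x ∷ xs) = φ x * ω xs - (φ ∧ ω ∘ (x ∷_)) xs

  ⋀ : List (X → Carrier) → Form
  ⋀ []      []      = 1#
  ⋀ []      (_ ∷ _) = 0#
  ⋀ (φ ∷ Φ) xs      = (φ ∧ ⋀ Φ) xs

  -‿cong₂ : ∀ {p q r s} → p ≈ q → r ≈ s → p - r ≈ q - s
  -‿cong₂ p≈q r≈s = +-cong p≈q (-‿cong r≈s)

  -‿interchange : ∀ p q r s → (p - q) - (r - s) ≈ (p - r) - (q - s)
  -‿interchange p q r s = begin
    (p - q) - (r - s)         ≈⟨ +-congˡ (-‿+-comm r (- s)) ⟨
    (p - q) + (- r + - - s)   ≈⟨ interchange p (- q) (- r) (- - s) ⟩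
    (p - r) + (- q + - - s)   ≈⟨ +-congˡ (-‿+-comm q (- s)) ⟩
    (p - r) - (q - s)         ∎

  x-0≈x : ∀ p → p - 0# ≈ p
  x-0≈x p = trans (+-congˡ -0#≈0#) (+-identityʳ p)

  0-0≈0 : 0# - 0# ≈ 0#
  0-0≈0 = -‿inverseʳ 0#

  ∧-congʳ : ∀ {φ ω η} → (∀ xs → ω xs ≈ η xs) → ∀ xs → (φ ∧ ω) xs ≈ (φ ∧ η) xs
  ∧-congʳ eq []       = refl
  ∧-congʳ eq (x ∷ xs) = -‿cong₂ (*-congˡ (eq xs)) (∧-congʳ (eq ∘ (x ∷_)) xs)

  ∧-congˡ : ∀ {φ ψ ω} → (∀ x → φ x ≈ ψ x) → ∀ xs → (φ ∧ ω) xs ≈ (ψ ∧ ω) xs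
  ∧-congˡ eq []       = refl
  ∧-congˡ eq (x ∷ xs) = -‿cong₂ (*-congʳ (eq x)) (∧-congˡ eq xs)

  a*0-0≈0 : ∀ a → a * 0# - 0# ≈ 0#
  a*0-0≈0 a = trans (x-0≈x _) (zeroʳ a)

  -- The combination `a * ω - η` is the shape into which a wedge unfolds on a nonempty list.
  ∧-linearʳ : ∀ φ a ω η xs →
    (φ ∧ (λ ys → a * ω ys - η ys)) xs ≈ a * (φ ∧ ω) xs - (φ ∧ η) xs
  ∧-linearʳ φ a ω η []       = sym (a*0-0≈0 a)
  ∧-linearʳ φ a ω η (x ∷ xs) = begin
    φ x * (a * ω xs - η xs) - (φ ∧ (λ ys → a * ω (x ∷ ys) - η (x ∷ ys))) xs
      ≈⟨ -‿cong₂ (x[y-z]≈xy-xz _ _ _) (∧-linearʳ φ a (ω ∘ (x ∷_)) (η ∘ (x ∷_)) xs) ⟩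
    (φ x * (a * ω xs) - φ x * η xs) - (a * W - H)
      ≈⟨ -‿interchange _ _ _ _ ⟩
    (φ x * (a * ω xs) - a * W) - (φ x * η xs - H)
      ≈⟨ +-congʳ (+-congʳ (x∙yz≈y∙xz _ _ _)) ⟩
    (a * (φ x * ω xs) - a * W) - (φ x * η xs - H)
      ≈⟨ +-congʳ (x[y-z]≈xy-xz _ _ _) ⟨
    a * (φ x * ω xs - W) - (φ x * η xs - H) ∎
    where
    W H : Carrier
    W = (φ ∧ ω ∘ (x ∷_)) xs
    H = (φ ∧ η ∘ (x ∷_)) xs

  ∧-linearˡ : ∀ a φ ψ ω xs →
    ((λ y → a * φ y - ψ y) ∧ ω) xs ≈ a * (φ ∧ ω) xs - (ψ ∧ ω) xs
  ∧-linearˡ a φ ψ ω []       = sym (a*0-0≈0 a)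
  ∧-linearˡ a φ ψ ω (x ∷ xs) = begin
    (a * φ x - ψ x) * ω xs - ((λ y → a * φ y - ψ y) ∧ ω ∘ (x ∷_)) xs
      ≈⟨ -‿cong₂ ([y-z]x≈yx-zx _ _ _) (∧-linearˡ a φ ψ (ω ∘ (x ∷_)) xs) ⟩
    (a * φ x * ω xs - ψ x * ω xs) - (a * W - H)
      ≈⟨ -‿interchange _ _ _ _ ⟩
    (a * φ x * ω xs - a * W) - (ψ x * ω xs - H)
      ≈⟨ +-congʳ (+-congʳ (*-assoc _ _ _)) ⟩
    (a * (φ x * ω xs) - a * W) - (ψ x * ω xs - H)
      ≈⟨ +-congʳ (x[y-z]≈xy-xz _ _ _) ⟨
    a * (φ x * ω xs - W) - (ψ x * ω xs - H) ∎
    where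
    W H : Carrier
    W = (φ ∧ ω ∘ (x ∷_)) xs
    H = (ψ ∧ ω ∘ (x ∷_)) xs

  ∧-zeroʳ : ∀ {φ ω} → (∀ xs → ω xs ≈ 0#) → ∀ xs → (φ ∧ ω) xs ≈ 0#
  ∧-zeroʳ ω≈0 []       = refl
  ∧-zeroʳ ω≈0 (x ∷ xs) =
    trans (-‿cong₂ (trans (*-congˡ (ω≈0 xs)) (zeroʳ _)) (∧-zeroʳ (ω≈0 ∘ (x ∷_)) xs)) 0-0≈0

  ∧-zeroˡ : ∀ {φ ω} → (∀ x → φ x ≈ 0#) → ∀ xs → (φ ∧ ω) xs ≈ 0#
  ∧-zeroˡ φ≈0 []       = refl
  ∧-zeroˡ φ≈0 (x ∷ xs) =
    trans (-‿cong₂ (trans (*-congʳ (φ≈0 x)) (zeroˡ _)) (∧-zeroˡ φ≈0 xs)) 0-0≈0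

  -- Contracting both sides with the first argument leaves the same `A` and `B`; induction, applied
  -- to `ι`, exchanges the factors in the remaining term.
  ∧-anticomm : ∀ φ ψ ω xs → (φ ∧ ψ ∧ ω) xs ≈ - (ψ ∧ φ ∧ ω) xs
  ∧-anticomm φ ψ ω []       = sym -0#≈0#
  ∧-anticomm φ ψ ω (x ∷ xs) = begin
    A - (φ ∧ (λ ys → ψ x * ω ys - (ψ ∧ ι) ys)) xs  ≈⟨ +-congˡ (-‿cong (∧-linearʳ φ (ψ x) ω (ψ ∧ ι) xs)) ⟩
    A - (B - (φ ∧ ψ ∧ ι) xs)                       ≈⟨ +-congˡ (-‿cong (-‿cong₂ refl (∧-anticomm φ ψ ι xs))) ⟩
    A - (B - - C)                                  ≈⟨ +-congˡ (-‿+-comm B (- - C)) ⟨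
    A + (- B - - - C)                              ≈⟨ +-congˡ (+-cong refl (-‿involutive (- C))) ⟩
    A + (- B - C)                                  ≈⟨ +-congˡ (+-comm _ _) ⟩
    A + (- C - B)                                  ≈⟨ +-assoc _ _ _ ⟨
    (A - C) - B                                    ≈⟨ ⁻¹-anti-homo‿- B (A - C) ⟨
    - (B - (A - C))                                ≈⟨ -‿cong (+-congˡ (-‿cong (∧-linearʳ ψ (φ x) ω (φ ∧ ι) xs))) ⟨
    - (B - (ψ ∧ (λ ys → φ x * ω ys - (φ ∧ ι) ys)) xs) ∎
    where
    ι : Form
    ι = ω ∘ (x ∷_)
    A B C : Carrier
    A = φ x * (ψ ∧ ω) xs
    B = ψ x * (φ ∧ ω) xs
    C = (ψ ∧ φ ∧ ι) xs

  -- Anticommutativity yields only p ≈ -p, which does not force 0 in every commutative ring; hence a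
  -- separate induction, in which the two copies of `A` cancel.
  ∧-square : ∀ φ ω xs → (φ ∧ φ ∧ ω) xs ≈ 0#
  ∧-square φ ω []       = refl
  ∧-square φ ω (x ∷ xs) = begin
    A - (φ ∧ (λ ys → φ x * ω ys - (φ ∧ ι) ys)) xs  ≈⟨ +-congˡ (-‿cong (∧-linearʳ φ (φ x) ω (φ ∧ ι) xs)) ⟩
    A - (A - (φ ∧ φ ∧ ι) xs)                       ≈⟨ +-congˡ (-‿cong (-‿cong₂ refl (∧-square φ ι xs))) ⟩
    A - (A - 0#)                                   ≈⟨ +-congˡ (-‿cong (x-0≈x A)) ⟩
    A - A                                          ≈⟨ -‿inverseʳ A ⟩
    0#                                             ∎
    where
    ι : Form
    ι = ω ∘ (x ∷_)
    A : Carrier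
    A = φ x * (φ ∧ ω) xs

  Annihilates : (X → Carrier) → Form → Set _
  Annihilates φ ω = ∀ xs → (φ ∧ ω) xs ≈ 0#

  ∈⇒annihilates : ∀ {φ Φ} → φ ∈ Φ → Annihilates φ (⋀ Φ)
  ∈⇒annihilates {φ} {_ ∷ Φ} (here ≡.refl) xs = ∧-square φ (⋀ Φ) xs
  ∈⇒annihilates {φ} {ψ ∷ Φ} (there φ∈Φ)   xs = begin
    (φ ∧ ψ ∧ ⋀ Φ) xs    ≈⟨ ∧-anticomm φ ψ (⋀ Φ) xs ⟩
    - (ψ ∧ φ ∧ ⋀ Φ) xs  ≈⟨ -‿cong (∧-zeroʳ (∈⇒annihilates φ∈Φ) xs) ⟩
    - 0#                ≈⟨ -0#≈0# ⟩
    0#                  ∎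

  -- For ω = ⋀ Φ these functionals lie in the span of Φ, which is why they annihilate ⋀ Φ.
  Contracts : Form → Form → Set _
  Contracts ω Ω = ∀ ls → Annihilates (λ y → ω (ls ++ [ y ])) Ω

  annihilates-linear : ∀ a {φ ψ Ω} → Annihilates φ Ω → Annihilates ψ Ω →
    Annihilates (λ y → a * φ y - ψ y) Ω
  annihilates-linear a {φ} {ψ} {Ω} p q xs = begin
    ((λ y → a * φ y - ψ y) ∧ Ω) xs   ≈⟨ ∧-linearˡ a φ ψ Ω xs ⟩
    a * (φ ∧ Ω) xs - (ψ ∧ Ω) xs      ≈⟨ -‿cong₂ (*-congˡ (p xs)) (q xs) ⟩
    a * 0# - 0#                      ≈⟨ a*0-0≈0 a ⟩
    0#                               ∎

  -- Unfolding at `l` gives a combination of two functionals annihilating `Ω`, one by `c` and one by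
  -- induction. At the empty list the functional is `ω []` times `φ`.
  ∧-contracts : ∀ {φ ω Ω} → Annihilates φ Ω → Contracts ω Ω → Contracts (φ ∧ ω) Ω
  ∧-contracts {φ} {ω} {Ω} p c []       xs = trans
    (∧-congˡ (λ y → +-congʳ (*-comm (φ y) (ω []))) xs)
    (annihilates-linear (ω []) p (∧-zeroˡ (λ _ → refl)) xs)
  ∧-contracts {φ} {ω} {Ω} p c (l ∷ ls) xs =
    annihilates-linear (φ l) (c ls) (∧-contracts p (c ∘ (l ∷_)) ls) xs

  ⋀-contracts : ∀ {Ω} Φ → (∀ {φ} → φ ∈ Φ → Annihilates φ Ω) → Contracts (⋀ Φ) Ω
  ⋀-contracts []      p []       = ∧-zeroˡ (λ _ → refl)
  ⋀-contracts []      p (l ∷ ls) = ∧-zeroˡ (λ _ → refl)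
  ⋀-contracts (φ ∷ Φ) p          = ∧-contracts (p (here ≡.refl)) (⋀-contracts Φ (p ∘ there))

  data Swap : List X → List X → Set x where
    here  : ∀ {y z xs} → Swap (y ∷ z ∷ xs) (z ∷ y ∷ xs)
    there : ∀ {y xs ys} → Swap xs ys → Swap (y ∷ xs) (y ∷ ys)

  Antisymmetric : Form → Set _
  Antisymmetric ω = ∀ {xs ys} → Swap xs ys → ω xs ≈ - ω ys

  ∧-negʳ : ∀ {φ ω η} → (∀ xs → ω xs ≈ - η xs) → ∀ xs → (φ ∧ ω) xs ≈ - (φ ∧ η) xs
  ∧-negʳ {φ} {ω} {η} eq []       = sym -0#≈0#
  ∧-negʳ {φ} {ω} {η} eq (x ∷ xs) = begin
    φ x * ω xs - (φ ∧ ω ∘ (x ∷_)) xs          ≈⟨ -‿cong₂ (*-congˡ (eq xs)) (∧-negʳ (eq ∘ (x ∷_)) xs) ⟩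
    φ x * - η xs - - (φ ∧ η ∘ (x ∷_)) xs      ≈⟨ +-congʳ (-‿distribʳ-* _ _) ⟨
    - (φ x * η xs) - - (φ ∧ η ∘ (x ∷_)) xs    ≈⟨ -‿+-comm _ _ ⟩
    - (φ x * η xs - (φ ∧ η ∘ (x ∷_)) xs)      ∎

  ∧-antisym : ∀ {φ ω} → Antisymmetric ω → Antisymmetric (φ ∧ ω)
  ∧-antisym {φ} {ω} anti {y ∷ z ∷ xs} here = begin
    A - (B - C)              ≈⟨ +-congˡ (⁻¹-anti-homo‿- B C) ⟩
    A + (C - B)              ≈⟨ +-assoc _ _ _ ⟨
    (A + C) - B              ≈⟨ ⁻¹-anti-homo‿- B (A + C) ⟨
    - (B - (A + C))          ≈⟨ -‿cong (+-congˡ (-‿cong (+-congˡ (∧-negʳ (λ _ → anti here) xs)))) ⟩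
    - (B - (A - C′))         ∎
    where
    A B C C′ : Carrier
    A  = φ y * ω (z ∷ xs)
    B  = φ z * ω (y ∷ xs)
    C  = (φ ∧ ω ∘ (y ∷_) ∘ (z ∷_)) xs
    C′ = (φ ∧ ω ∘ (z ∷_) ∘ (y ∷_)) xs
  ∧-antisym {φ} {ω} anti {y ∷ xs} {_ ∷ ys} (there s) = begin
    φ y * ω xs - (φ ∧ ω ∘ (y ∷_)) xs          ≈⟨ -‿cong₂ (*-congˡ (anti s)) (∧-antisym (anti ∘ there) s) ⟩
    φ y * - ω ys - - (φ ∧ ω ∘ (y ∷_)) ys      ≈⟨ +-congʳ (-‿distribʳ-* _ _) ⟨
    - (φ y * ω ys) - - (φ ∧ ω ∘ (y ∷_)) ys    ≈⟨ -‿+-comm _ _ ⟩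
    - (φ y * ω ys - (φ ∧ ω ∘ (y ∷_)) ys)      ∎

  ⋀-antisym : ∀ Φ → Antisymmetric (⋀ Φ)
  ⋀-antisym []      here      = sym -0#≈0#
  ⋀-antisym []      (there s) = sym -0#≈0#
  ⋀-antisym (φ ∷ Φ) s         = ∧-antisym (⋀-antisym Φ) s

  ʳ++-swap : ∀ qs {xs ys} → Swap xs ys → Swap (qs ʳ++ xs) (qs ʳ++ ys)
  ʳ++-swap []       s = s
  ʳ++-swap (q ∷ qs) s = ʳ++-swap qs (there s)

  ʳ++-++ : ∀ (qs xs ys : List X) → (qs ʳ++ xs) ++ ys ≡.≡ qs ʳ++ (xs ++ ys)
  ʳ++-++ []       xs ys = ≡.refl
  ʳ++-++ (q ∷ qs) xs ys = ʳ++-++ qs (q ∷ xs) ys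

  -- At `q ∷ xs` the wedge `ψ ∧ ω` is `ψ q * ω xs` minus the wedge of `ψ` with the contraction by
  -- `q`, so contracting by a zero of `ψ` preserves annihilation.
  annihilates-contraction : ∀ {ψ Ω} qs → Annihilates ψ Ω → (∀ {q} → q ∈ qs → ψ q ≈ 0#) →
    Annihilates ψ (Ω ∘ (qs ʳ++_))
  annihilates-contraction []       ann z = ann
  annihilates-contraction {ψ} {Ω} (q ∷ qs) ann z xs = begin
    (ψ ∧ ω ∘ (q ∷_)) xs                    ≈⟨ x∙y⁻¹≈ε⇒x≈y _ _ (annihilates-contraction qs ann (z ∘ there) (q ∷ xs)) ⟨
    ψ q * ω xs                             ≈⟨ *-congʳ (z (here ≡.refl)) ⟩
    0# * ω xs                              ≈⟨ zeroˡ _ ⟩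
    0#                                     ∎
    where
    ω : Form
    ω = Ω ∘ (qs ʳ++_)

  module Plücker (half : ∀ {p} → p ≈ - p → p ≈ 0#) where

    -- `half` excludes 2-torsion: once the equal arguments are adjacent, swapping them gives p ≈ -p.
    head-repeated : ∀ {ω y xs} → Antisymmetric ω → y ∈ xs → ω (y ∷ xs) ≈ 0#
    head-repeated anti (here ≡.refl) = half (anti here)
    head-repeated {ω} {y} {z ∷ xs} anti (there y∈xs) = begin
      ω (y ∷ z ∷ xs)    ≈⟨ anti here ⟩
      - ω (z ∷ y ∷ xs)  ≈⟨ -‿cong (head-repeated {ω ∘ (z ∷_)} (anti ∘ there) y∈xs) ⟩
      - 0#              ≈⟨ -0#≈0# ⟩
      0#                ∎

    repeated : ∀ {ω y} qs {xs} → Antisymmetric ω → y ∈ qs → y ∈ xs → ω (qs ʳ++ xs) ≈ 0#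
    repeated {ω} (q ∷ qs) anti (here ≡.refl) y∈xs =
      head-repeated {ω ∘ (qs ʳ++_)} (anti ∘ ʳ++-swap qs) y∈xs
    repeated (q ∷ qs) anti (there y∈qs) y∈xs = repeated qs anti y∈qs (there y∈xs)

    -- As a contraction of `⋀ Φ`, the functional `ψ` annihilates `⋀ Φ`; it vanishes on `qs` because
    -- an argument is repeated. Hence `ψ ∧ ω` is zero, and its value at `i`, `j`, `k` is A - B + C.
    plücker : ∀ Φ qs r i j k → let ω = ⋀ Φ ∘ (qs ʳ++_) in
      ω (r ∷ j ∷ []) * ω (i ∷ k ∷ []) ≈
      ω (r ∷ i ∷ []) * ω (j ∷ k ∷ []) + ω (r ∷ k ∷ []) * ω (i ∷ j ∷ [])
    plücker Φ qs r i j k = begin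
      B               ≈⟨ +-identityʳ B ⟨
      B + 0#          ≈⟨ +-congˡ ψ∧ω≈0 ⟨
      B + (A - (B - (C - 0#)))  ≈⟨ +-congˡ (+-congˡ (-‿cong (+-congˡ (-‿cong (x-0≈x C))))) ⟩
      B + (A - (B - C))  ≈⟨ +-congˡ (+-congˡ (⁻¹-anti-homo‿- B C)) ⟩
      B + (A + (C - B))  ≈⟨ +-congˡ (+-assoc _ _ _) ⟨
      B + ((A + C) - B)  ≈⟨ +-assoc _ _ _ ⟨
      B + (A + C) - B    ≈⟨ xyx⁻¹≈y B (A + C) ⟩
      A + C              ∎
      where
      ω : Form
      ω = ⋀ Φ ∘ (qs ʳ++_)
      ψ : X → Carrier
      ψ y = ω (r ∷ y ∷ [])
      A B C : Carrier
      A = ψ i * ω (j ∷ k ∷ [])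
      B = ψ j * ω (i ∷ k ∷ [])
      C = ψ k * ω (i ∷ j ∷ [])
      ψ-annihilates : Annihilates ψ (⋀ Φ)
      ψ-annihilates xs = trans
        (∧-congˡ (λ y → reflexive (≡.cong (⋀ Φ) (≡.sym (ʳ++-++ qs [ r ] [ y ])))) xs)
        (⋀-contracts Φ ∈⇒annihilates (qs ʳ++ [ r ]) xs)
      ψ∧ω≈0 : (ψ ∧ ω) (i ∷ j ∷ k ∷ []) ≈ 0#
      ψ∧ω≈0 = annihilates-contraction qs ψ-annihilates
        (λ q∈qs → repeated qs (⋀-antisym Φ) q∈qs (there (here ≡.refl))) (i ∷ j ∷ k ∷ [])


-- Determinants as wedges of row functionals.

module DetWedge {a ℓ} (F : OrderedField a ℓ) {x} (X : Set x) where
  open OrderedField F using (commRing; Carrier; _≈_; _+_; _*_; -_; 0#; 1#)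
  open CommutativeRing commRing
    using (ring; setoid; refl; sym; trans; +-cong; +-congˡ; -‿cong; *-congˡ; *-congʳ; *-identityˡ)
  open Algebra.Properties.Ring ring
  open Relation.Binary.Reasoning.Setoid setoid
  open Wedge commRing X

  Σᶠ-cong : ∀ n {f g : Fin n → Carrier} → (∀ j → f j ≈ g j) → Σᶠ F n f ≈ Σᶠ F n g
  Σᶠ-cong zero    eq = refl
  Σᶠ-cong (suc n) eq = +-cong (eq zero) (Σᶠ-cong n (eq ∘ suc))

  Σᶠ-neg : ∀ n (f : Fin n → Carrier) → Σᶠ F n (λ j → - f j) ≈ - Σᶠ F n f
  Σᶠ-neg zero    f = sym -0#≈0#
  Σᶠ-neg (suc n) f = trans (+-congˡ (Σᶠ-neg n (f ∘ suc))) (-‿+-comm _ _)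

  -- Deleting `v zero` gives the leading term of the wedge. Every other deletion keeps `v zero` in
  -- front and carries an extra sign, so these terms form the expansion for the contraction by
  -- `v zero`.
  laplace : ∀ n φ ω (v : Fin (suc n) → X) →
    Σᶠ F (suc n) (λ j → (altSign F j * φ (v j)) * ω (tabulate (v ∘ punchIn j))) ≈
    (φ ∧ ω) (tabulate v)
  laplace zero    φ ω v = +-cong (*-congʳ (*-identityˡ _)) (sym -0#≈0#)
  laplace (suc n) φ ω v = +-cong (*-congʳ (*-identityˡ _)) (begin
    Σᶠ F (suc n) (λ j → (- altSign F j * φ (v (suc j))) * η j)
      ≈⟨ Σᶠ-cong (suc n) {λ j → (- altSign F j * φ (v (suc j))) * η j} (λ j →
           trans (*-congʳ (sym (-‿distribˡ-* (altSign F j) _))) (sym (-‿distribˡ-* _ (η j)))) ⟩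
    Σᶠ F (suc n) (λ j → - ((altSign F j * φ (v (suc j))) * η j))
      ≈⟨ Σᶠ-neg (suc n) (λ j → (altSign F j * φ (v (suc j))) * η j) ⟩
    - Σᶠ F (suc n) (λ j → (altSign F j * φ (v (suc j))) * η j)
      ≈⟨ -‿cong (laplace n φ (ω ∘ (v zero ∷_)) (v ∘ suc)) ⟩
    - (φ ∧ ω ∘ (v zero ∷_)) (tabulate (v ∘ suc)) ∎)
    where
    η : Fin (suc n) → Carrier
    η j = ω (v zero ∷ tabulate (v ∘ suc ∘ punchIn j))

  det≈⋀ : ∀ n (φ : Fin n → X → Carrier) (v : Fin n → X) →
    det F n (λ i k → φ i (v k)) ≈ ⋀ (tabulate φ) (tabulate v)
  det≈⋀ zero    φ v = refl
  det≈⋀ (suc n) φ v = trans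
    (Σᶠ-cong (suc n) (λ j → *-congˡ {altSign F j * φ zero (v j)} (det≈⋀ n (φ ∘ suc) (v ∘ punchIn j))))
    (laplace n (φ zero) (⋀ (tabulate (φ ∘ suc))) v)

-- Signs in ordered fields.

module OrderedFieldProperties {a ℓ} (F : OrderedField a ℓ) where
  open OrderedField F using (commRing; _<ᶠ′_; <-resp-≈; <-irrefl; <-trans; <-trichot; +-mono-<; *-pos)
  open CommutativeRing commRing
  open Algebra.Properties.Ring ring

  pos⇒neg : ∀ {p} → 0# <ᶠ′ p → (- p) <ᶠ′ 0#
  pos⇒neg {p} 0<p = <-resp-≈ (+-identityˡ (- p)) (-‿inverseʳ p) (+-mono-< (- p) 0<p)

  neg⇒pos : ∀ {p} → p <ᶠ′ 0# → 0# <ᶠ′ (- p)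
  neg⇒pos {p} p<0 = <-resp-≈ (-‿inverseʳ p) (+-identityˡ (- p)) (+-mono-< (- p) p<0)

  p≈-p⇒p≈0 : ∀ {p} → p ≈ - p → p ≈ 0#
  p≈-p⇒p≈0 {p} e with <-trichot 0# p
  ... | inj₁ 0<p        = ⊥-elim (<-irrefl (<-trans 0<p (<-resp-≈ (sym e) refl (pos⇒neg 0<p))))
  ... | inj₂ (inj₁ 0≈p) = sym 0≈p
  ... | inj₂ (inj₂ p<0) = ⊥-elim (<-irrefl (<-trans p<0 (<-resp-≈ refl (sym e) (neg⇒pos p<0))))

  +-pos : ∀ {p q} → 0# <ᶠ′ p → 0# <ᶠ′ q → 0# <ᶠ′ (p + q)
  +-pos {p} {q} 0<p 0<q = <-trans 0<q (<-resp-≈ (+-identityˡ q) refl (+-mono-< q 0<p))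

  *-pos-cancel : ∀ {p q} → 0# <ᶠ′ p → 0# <ᶠ′ (p * q) → 0# <ᶠ′ q
  *-pos-cancel {p} {q} 0<p 0<pq with <-trichot 0# q
  ... | inj₁ 0<q        = 0<q
  ... | inj₂ (inj₁ 0≈q) = ⊥-elim (<-irrefl (<-resp-≈ refl (trans (*-congˡ (sym 0≈q)) (zeroʳ p)) 0<pq))
  ... | inj₂ (inj₂ q<0) = ⊥-elim (<-irrefl (<-trans (pos⇒neg 0<pq)
          (<-resp-≈ refl (sym (-‿distribʳ-* p q)) (*-pos 0<p (neg⇒pos q<0)))))

  -- The shape of the Plücker relation: `u`, `v`, `w` are the brackets of a reference point with i,
  -- j, k, and `p`, `q`, `r` are [j,k], [i,j], [i,k].
  combination-pos : ∀ {u v w p q r} → 0# <ᶠ′ u → 0# <ᶠ′ v → 0# <ᶠ′ w → 0# <ᶠ′ p → 0# <ᶠ′ q →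
    v * r ≈ u * p + w * q → 0# <ᶠ′ r
  combination-pos 0<u 0<v 0<w 0<p 0<q e =
    *-pos-cancel 0<v (<-resp-≈ refl (sym e) (+-pos (*-pos 0<u 0<p) (*-pos 0<w 0<q)))

  negate-combination : ∀ {u v w p q r} → v * r ≈ u * p + w * q → - v * r ≈ - u * p + - w * q
  negate-combination {u} {v} {w} {p} {q} {r} e =
    trans (sym (-‿distribˡ-* v r)) (trans (-‿cong e) (trans (sym (-‿+-comm _ _))
      (+-cong (-‿distribˡ-* u p) (-‿distribˡ-* w q))))

  -- Zero is coloured `false`; general position later turns `false` into a negative sign.
  positive? : Carrier → Bool
  positive? p with <-trichot 0# p
  ... | inj₁ _ = true
  ... | inj₂ _ = false

  positive?-true : ∀ {p} → positive? p ≡.≡ true → 0# <ᶠ′ p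
  positive?-true {p} e with <-trichot 0# p
  ... | inj₁ 0<p = 0<p

  true-positive? : ∀ {p} → 0# <ᶠ′ p → positive? p ≡.≡ true
  true-positive? {p} 0<p with <-trichot 0# p
  ... | inj₁ _          = ≡.refl
  ... | inj₂ (inj₁ 0≈p) = ⊥-elim (<-irrefl (<-resp-≈ refl (sym 0≈p) 0<p))
  ... | inj₂ (inj₂ p<0) = ⊥-elim (<-irrefl (<-trans 0<p p<0))

  positive?-false : ∀ {p} → ¬ p ≈ 0# → positive? p ≡.≡ false → p <ᶠ′ 0#
  positive?-false {p} p≉0 e with <-trichot 0# p
  ... | inj₂ (inj₁ 0≈p) = ⊥-elim (p≉0 (sym 0≈p))
  ... | inj₂ (inj₂ p<0) = p<0

-- Ramsey theory of lists: an ordered set is a list and its tuples are its sublists.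

import Data.Bool.Properties as Bool
import Data.Fin.Properties as Fin
open import Data.List using (map; length; take; reverse; cartesianProductWith; allFin) renaming (lookup to nth)
open import Data.List.Membership.Propositional.Properties
  using (∈-map⁺; ∈-cartesianProductWith⁺; ∈-tabulate⁺)
open import Data.List.Properties
  using (length-map; length-++; length-ʳ++; length-reverse; length-tabulate; length-take;
         reverse-involutive; tabulate-lookup)
open import Data.List.Relation.Binary.Sublist.Propositional
  using (_⊆_; []; _∷_; _∷ʳ_; ⊆-refl; ⊆-trans; minimum; lookup; from∈)
open import Data.List.Relation.Binary.Sublist.Propositional.Properties using (ʳ++⁺; All-resp-⊆; take-⊆)
open import Data.List.Relation.Unary.All as All using (All; []; _∷_)
import Data.List.Relation.Unary.All.Properties as All
open import Data.List.Relation.Unary.AllPairs as AllPairs using (AllPairs; []; _∷_)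
open import Data.List.Relation.Unary.AllPairs.Properties using (tabulate⁺-<)
open import Data.Nat using (_+_; _*_; _<_; z≤n; s≤s; >-nonZero)
open import Data.Nat.ListAction using (sum)
open import Data.Nat.Properties
open import Data.Product using (∃; ∃₂; _×_; _,_)
open import Data.Unit.Polymorphic using (⊤; tt)
open import Relation.Binary.PropositionalEquality using (_≡_; refl; sym; trans; cong; cong₂; subst)

2*t≤m+n⇒t≤m⊎t≤n : ∀ t {m n} → 2 * t ≤ m + n → t ≤ m ⊎ t ≤ n
2*t≤m+n⇒t≤m⊎t≤n t {m} {n} le with t ≤? m | t ≤? n
... | yes t≤m | _       = inj₁ t≤m
... | no _    | yes t≤n = inj₂ t≤n
... | no t≰m  | no t≰n  = ⊥-elim (<⇒≱ m+n<2*t le)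
  where
  m+n<2*t : m + n < 2 * t
  m+n<2*t = subst (m + n <_) (cong (t +_) (sym (+-identityʳ t))) (+-mono-< (≰⇒> t≰m) (≰⇒> t≰n))

module Colouring {a} (A : Set a) where

  Constant : (A → Bool) → List A → Set a
  Constant f xs = ∃ λ c → ∀ {x} → x ∈ xs → f x ≡ c

  Homogeneous : (List A → Bool) → ℕ → List A → Set a
  Homogeneous χ k xs = ∃ λ c → ∀ {zs} → zs ⊆ xs → length zs ≡ k → χ zs ≡ c

  HasHomogeneous : (List A → Bool) → ℕ → ℕ → List A → Set a
  HasHomogeneous χ k n xs = ∃ λ ys → ys ⊆ xs × n ≤ length ys × Homogeneous χ k ys

  partition : ∀ (f : A → Bool) xs → ∃₂ λ ys zs → ys ⊆ xs × zs ⊆ xs ×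
    All (λ y → f y ≡ true) ys × All (λ z → f z ≡ false) zs × length xs ≡ length ys + length zs
  partition f []       = [] , [] , [] , [] , [] , [] , refl
  partition f (x ∷ xs) with partition f xs | f x in fx
  ... | ys , zs , p , q , r , s , e | true  =
    x ∷ ys , zs , refl ∷ p , x ∷ʳ q , fx ∷ r , s , cong suc e
  ... | ys , zs , p , q , r , s , e | false =
    ys , x ∷ zs , x ∷ʳ p , refl ∷ q , r , fx ∷ s , trans (cong suc e) (sym (+-suc (length ys) (length zs)))

  halve : ∀ f xs t → 2 * t ≤ length xs → ∃ λ ys → ys ⊆ xs × t ≤ length ys × Constant f ys
  halve f xs t le with partition f xs
  ... | ys , zs , p , q , r , s , e with 2*t≤m+n⇒t≤m⊎t≤n t (subst (2 * t ≤_) e le)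
  ...   | inj₁ t≤ = ys , p , t≤ , true  , All.lookup r
  ...   | inj₂ t≤ = zs , q , t≤ , false , All.lookup s

  unify : ∀ (L : List (A → Bool)) xs t → 2 ^ length L * t ≤ length xs →
    ∃ λ ys → ys ⊆ xs × t ≤ length ys × (∀ {f} → f ∈ L → Constant f ys)
  unify []      xs t le = xs , ⊆-refl , subst (_≤ length xs) (+-identityʳ t) le , λ ()
  unify (f ∷ L) xs t le
    with ys , ys⊆xs , le₁ , c , fc ← halve f xs (2 ^ length L * t)
           (subst (_≤ length xs) (*-assoc 2 (2 ^ length L) t) le)
    with zs , zs⊆ys , le₂ , const ← unify L ys t le₁
    = zs , ⊆-trans zs⊆ys ys⊆xs , le₂ , λ where
        (here refl)  → c , fc ∘ lookup zs⊆ys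
        (there g∈L)  → const g∈L

  -- All lists over S, not only its sublists: the count |S|^k is good enough for the tower bound.
  tuples : ℕ → List A → List (List A)
  tuples zero    S = [ [] ]
  tuples (suc k) S = cartesianProductWith _∷_ S (tuples k S)

  length-product : ∀ {b c} {B : Set b} {C : Set c} (f : A → B → C) xs ys →
    length (cartesianProductWith f xs ys) ≡ length xs * length ys
  length-product f []       ys = refl
  length-product f (x ∷ xs) ys = trans (length-++ (map (f x) ys))
    (cong₂ _+_ (length-map (f x) ys) (length-product f xs ys))

  length-tuples : ∀ k S → length (tuples k S) ≡ length S ^ k
  length-tuples zero    S = refl
  length-tuples (suc k) S = trans (length-product _∷_ S (tuples k S)) (cong (length S *_) (length-tuples k S))

  ⊆⇒∈-tuples : ∀ {S zs} → All (_∈ S) zs → zs ∈ tuples (length zs) S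
  ⊆⇒∈-tuples []         = here refl
  ⊆⇒∈-tuples (z∈ ∷ zs∈) = ∈-cartesianProductWith⁺ _∷_ z∈ (⊆⇒∈-tuples zs∈)

  ʳ++-⊆ : ∀ (xs ys : List A) → ys ⊆ xs ʳ++ ys
  ʳ++-⊆ []       ys = ⊆-refl
  ʳ++-⊆ (x ∷ xs) ys = ⊆-trans (x ∷ʳ ⊆-refl) (ʳ++-⊆ xs (x ∷ ys))

  -- The Erdős-Rado step.

  module ErdősRado (χ : List A → Bool) (k : ℕ) where

    -- Makes `q` a substitute for the first element of any tuple from `S`. Each `b` is compared with
    -- `q` only on tuples over the entries behind it.
    EndHomogeneous : A → List A → Set a
    EndHomogeneous q []      = ⊤
    EndHomogeneous q (b ∷ S) = (∀ {zs} → zs ∈ tuples k S → χ (q ∷ zs) ≡ χ (b ∷ zs)) × EndHomogeneous q S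

    end-homogeneous : ∀ {q S z zs} → EndHomogeneous q S → z ∷ zs ⊆ S → length zs ≡ k →
      χ (z ∷ zs) ≡ χ (q ∷ zs)
    end-homogeneous (_ , h) (_ ∷ʳ p)    e = end-homogeneous h p e
    end-homogeneous (h , _) (refl ∷ p) refl = sym (h (⊆⇒∈-tuples (All.tabulate (lookup p))))

    homogeneous : ∀ {q S ys} → EndHomogeneous q S → ys ⊆ S → ∀ c →
      (∀ {zs} → zs ⊆ ys → length zs ≡ k → χ (q ∷ zs) ≡ c) → Homogeneous χ (suc k) ys
    homogeneous {ys = ys} end ys⊆S c hc = c , colour
      where
      colour : ∀ {zs} → zs ⊆ ys → length zs ≡ suc k → χ zs ≡ c
      colour {z ∷ zs} p e = trans
        (end-homogeneous end (⊆-trans p ys⊆S) (suc-injective e))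
        (hc (⊆-trans (z ∷ʳ ⊆-refl) p) (suc-injective e))

    Uniform : List A → List A → Set a
    Uniform S xs = ∀ {zs} → zs ∈ tuples k S → Constant (λ x → χ (x ∷ zs)) xs

    -- There are at most `M ^ k` tests, each costing one halving. The further factor 2 in
    -- `suc (M ^ k)` pays for the element just picked, which `suc (length xs)` counts.
    make-uniform : ∀ {M} m S xs → length S + m ≡ M →
      2 ^ (suc m * suc (M ^ k)) ≤ suc (length xs) →
      ∃ λ ys → ys ⊆ xs × 2 ^ (m * suc (M ^ k)) ≤ length ys × Uniform S ys
    make-uniform {M} m S xs e le =
      let ys , ys⊆xs , le′ , const = unify tests xs t (≤-trans (*-monoˡ-≤ t (^-monoʳ-≤ 2 tests≤)) bound)
      in ys , ys⊆xs , le′ , λ zs∈ → const (∈-map⁺ test zs∈)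
      where
      test : List A → A → Bool
      test zs x = χ (x ∷ zs)
      tests : List (A → Bool)
      tests = map test (tuples k S)
      T t : ℕ
      t = 2 ^ (m * suc (M ^ k))
      T = 2 ^ (M ^ k) * t
      open ≤-Reasoning
      tests≤ : length tests ≤ M ^ k
      tests≤ = begin
        length tests         ≡⟨ length-map test (tuples k S) ⟩
        length (tuples k S)  ≡⟨ length-tuples k S ⟩
        length S ^ k         ≤⟨ ^-monoˡ-≤ k (subst (length S ≤_) e (m≤m+n _ m)) ⟩
        M ^ k                ∎
      T≡ : 2 ^ (M ^ k + m * suc (M ^ k)) ≡ T
      T≡ = ^-distribˡ-+-* 2 (M ^ k) (m * suc (M ^ k))
      bound : T ≤ length xs
      bound = ≤-pred (begin
        suc T                      ≤⟨ +-monoˡ-≤ T (subst (0 <_) T≡ (m^n>0 2 (M ^ k + m * suc (M ^ k)))) ⟩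
        T + T                      ≡⟨ cong (T +_) (+-identityʳ T) ⟨
        2 * T                      ≡⟨ cong (2 *_) T≡ ⟨
        2 ^ (suc m * suc (M ^ k))  ≤⟨ le ⟩
        suc (length xs)            ∎)

    -- The final elements are picked first, so the remaining ones are stored in reverse: the set in its
    -- original order is xs ʳ++ S.
    grow : ∀ {M} m S xs {ws} → length S + m ≡ M → 2 ^ (m * suc (M ^ k)) ≤ length xs →
      Uniform S xs → (∀ {x} → x ∈ xs → EndHomogeneous x S) → xs ʳ++ S ⊆ ws →
      ∃₂ λ q T → q ∷ T ⊆ ws × length T ≡ M × EndHomogeneous q T
    -- The bound `2 ^ 0` still leaves one candidate, which becomes `q`.
    grow zero    S (q ∷ xs) e le u h p =
      q , S , ⊆-trans (ʳ++-⊆ xs (q ∷ S)) p , trans (sym (+-identityʳ _)) e , h (here refl)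
    grow {M} (suc m) S [] e le u h p = ⊥-elim (<⇒≱ (m^n>0 2 (suc m * suc (M ^ k))) le)
    grow {M} (suc m) S (b ∷ xs) e le u h p
      with e′ ← trans (sym (+-suc (length S) m)) e
      with ys , ys⊆xs , le′ , u′ ← make-uniform m (b ∷ S) xs e′ le
      = grow m (b ∷ S) ys e′ le′ u′
          -- Uniformity over the old `S` makes each survivor agree with `b`: the new clause of
          -- `EndHomogeneous`.
          (λ y∈ → (λ zs∈ → same (u zs∈) (there (lookup ys⊆xs y∈))) , h (there (lookup ys⊆xs y∈)))
          (⊆-trans (ʳ++⁺ ys⊆xs (refl ∷ ⊆-refl)) p)
      where
      same : ∀ {f x} → Constant f (b ∷ xs) → x ∈ b ∷ xs → f x ≡ f b
      same (c , fc) x∈ = trans (fc x∈) (sym (fc (here refl)))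

  -- On `S` the colour ignores the first element, so a set homogeneous for the link `χ ∘ (q ∷_)` is
  -- homogeneous for `χ`. The last hypothesis concerns links inside `xs`, to which transitivity will
  -- be passed down.
  erdős-rado : ∀ k χ M n xs → 2 ^ (M * suc (M ^ suc k)) ≤ length xs →
    (∀ {q S} → q ∷ S ⊆ xs → M ≤ length S → HasHomogeneous (χ ∘ (q ∷_)) (suc k) n S) →
    HasHomogeneous χ (suc (suc k)) n xs
  erdős-rado k χ M n xs le hom
    -- The supply is reversed because final elements are picked first. Uniformity holds initially:
    -- there are no tuples of positive length over the empty list.
    with q , S , qS⊆xs , e , end ← ErdősRado.grow χ (suc k) M [] (reverse xs) refl
           (subst (_ ≤_) (sym (length-reverse xs)) le) (λ ()) (λ _ → tt)
           (subst (_⊆ xs) (sym (reverse-involutive xs)) ⊆-refl)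
    with ys , ys⊆S , n≤ , c , hc ← hom qS⊆xs (≤-reflexive (sym e))
    = ys , ⊆-trans ys⊆S (⊆-trans (q ∷ʳ ⊆-refl) qS⊆xs) , n≤ ,
      ErdősRado.homogeneous χ (suc k) end ys⊆S c hc

  -- Homogeneous sets for transitive colourings of pairs.

  AllPairs-⊆ : ∀ {p} {P : A → A → Set p} {x y xs} → AllPairs P xs → x ∷ y ∷ [] ⊆ xs → P x y
  AllPairs-⊆ (_ ∷ ps)  (_ ∷ʳ p)   = AllPairs-⊆ ps p
  AllPairs-⊆ (px ∷ ps) (refl ∷ p) = All.lookup px (lookup p (here refl))

  -- No order on `i`, `j`, `k` is imposed: the Plücker relation holds in any order.
  TransitiveOn : (List A → Bool) → List A → Set a
  TransitiveOn χ xs = ∀ {i j k} → i ∈ xs → j ∈ xs → k ∈ xs →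
    χ (i ∷ j ∷ []) ≡ true → χ (j ∷ k ∷ []) ≡ true → χ (i ∷ k ∷ []) ≡ true

  -- Patience sorting: every element is put into the first bucket in which it has no
  -- true-coloured successor, so the bucket number bounds the longest chain from below.
  module Patience (χ : List A → Bool) where

    _⇝_ : A → A → Set
    x ⇝ y = χ (x ∷ y ∷ []) ≡ true

    ChainFrom : List A → ℕ → A → Set a
    ChainFrom xs i y = ∃ λ zs → y ∷ zs ⊆ xs × length zs ≡ i × AllPairs _⇝_ (y ∷ zs)

    Buckets : List A → ℕ → List (List A) → Set a
    Buckets xs i []       = ⊤
    Buckets xs i (B ∷ bs) =
      B ⊆ xs × AllPairs (λ x y → ¬ x ⇝ y) B × (∀ {y} → y ∈ B → ChainFrom xs i y) × Buckets xs (suc i) bs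

    total : List (List A) → ℕ
    total bs = sum (map length bs)

    ChainFrom-skip : ∀ {x xs i y} → ChainFrom xs i y → ChainFrom (x ∷ xs) i y
    ChainFrom-skip {x} (zs , p , rest) = zs , x ∷ʳ p , rest

    Buckets-skip : ∀ {x xs i} bs → Buckets xs i bs → Buckets (x ∷ xs) i bs
    Buckets-skip     []       _             = tt
    Buckets-skip {x} (B ∷ bs) (p , q , c , b) = x ∷ʳ p , q , ChainFrom-skip ∘ c , Buckets-skip bs b

    -- A chain asks for all pairs, not only neighbouring ones; transitivity carries `x ⇝ y` along
    -- the rest.
    ChainFrom-cons : ∀ {x xs i y} → TransitiveOn χ (x ∷ xs) → x ⇝ y → ChainFrom xs i y →
      ChainFrom (x ∷ xs) (suc i) x
    ChainFrom-cons {y = y} tr x⇝y (zs , p , e , y⇝zs ∷ ch) =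
      y ∷ zs , refl ∷ p , cong suc e , (x⇝y ∷ All.tabulate x⇝) ∷ y⇝zs ∷ ch
      where
      x⇝ : ∀ {z} → z ∈ zs → _ ⇝ z
      x⇝ z∈ = tr (here refl) (there (lookup p (here refl))) (there (lookup p (there z∈))) x⇝y (All.lookup y⇝zs z∈)

    -- When a bucket refuses `x`, a successor of `x` there starts a chain that `x` lengthens by one,
    -- as the next bucket requires. Refusal by all buckets leaves the long chain.
    insert : ∀ {x xs i} bs → TransitiveOn χ (x ∷ xs) → Buckets xs i bs → ChainFrom (x ∷ xs) i x →
      (∃ λ bs′ → length bs′ ≡ length bs × total bs′ ≡ suc (total bs) × Buckets (x ∷ xs) i bs′) ⊎
      ChainFrom (x ∷ xs) (i + length bs) x
    insert {i = i} [] tr b c = inj₂ (subst (λ m → ChainFrom _ m _) (sym (+-identityʳ i)) c)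
    insert {x} {xs} {i} (B ∷ bs) tr (p , q , ch , b) c
      with any? (λ y → χ (x ∷ y ∷ []) Bool.≟ true) B
    ... | no x⇝̸ = inj₁ ((x ∷ B) ∷ bs , refl , refl , refl ∷ p , All.¬Any⇒All¬ B x⇝̸ ∷ q ,
            (λ where (here refl) → c
                     (there y∈)  → ChainFrom-skip (ch y∈)) , Buckets-skip bs b)
    ... | yes x⇝ with y , y∈ , x⇝y ← find x⇝ with insert bs tr b (ChainFrom-cons tr x⇝y (ch y∈))
    ...   | inj₁ (bs′ , l , t , b′) = inj₁ (B ∷ bs′ , cong suc l ,
              trans (cong (length B +_) t) (+-suc (length B) (total bs)) ,
              x ∷ʳ p , q , ChainFrom-skip ∘ ch , b′)
    ...   | inj₂ c′ = inj₂ (subst (λ m → ChainFrom (x ∷ xs) m x) (sym (+-suc i (length bs))) c′)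

    empty : ∀ m {i} → ∃ λ bs → length bs ≡ m × total bs ≡ 0 × Buckets [] i bs
    empty zero    = [] , refl , refl , tt
    empty (suc m) with bs , l , t , b ← empty m =
      [] ∷ bs , cong suc l , t , [] , [] , (λ ()) , b

    patience : ∀ m xs → TransitiveOn χ xs →
      (∃ λ bs → length bs ≡ m × total bs ≡ length xs × Buckets xs 0 bs) ⊎ ∃ (ChainFrom xs m)
    patience m []       tr = inj₁ (empty m)
    patience m (x ∷ xs) tr with patience m xs (λ i j k → tr (there i) (there j) (there k))
    ... | inj₂ (y , c)            = inj₂ (y , ChainFrom-skip c)
    ... | inj₁ (bs , refl , t , b) with insert bs tr b ([] , refl ∷ minimum xs , refl , [] ∷ [])
    ...   | inj₁ (bs′ , l , t′ , b′) = inj₁ (bs′ , l , trans t′ (cong suc t) , b′)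
    ...   | inj₂ c = inj₂ (x , c)

    large-bucket : ∀ {xs i} n b bs → Buckets xs i (b ∷ bs) → suc (length bs) * n ≤ total (b ∷ bs) →
      ∃ λ B → B ⊆ xs × AllPairs (λ x y → ¬ x ⇝ y) B × n ≤ length B
    large-bucket n B bs bk le with n ≤? length B
    large-bucket n B bs (p , q , _) le            | yes n≤ = B , p , q , n≤
    large-bucket n B [] bk le                     | no n≰  =
      ⊥-elim (n≰ (subst (n ≤_) (+-identityʳ _) (subst (_≤ length B + 0) (+-identityʳ n) le)))
    large-bucket n B (B′ ∷ bs) (_ , _ , _ , bk) le | no n≰ = large-bucket n B′ bs bk
      (≮⇒≥ (λ lt → <⇒≱ (+-mono-< (≰⇒> n≰) lt) le))

  pairs-homogeneous : ∀ χ c {xs} → AllPairs (λ x y → χ (x ∷ y ∷ []) ≡ c) xs → Homogeneous χ 2 xs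
  pairs-homogeneous χ c {xs} ps = c , colour
    where
    colour : ∀ {zs} → zs ⊆ xs → length zs ≡ 2 → χ zs ≡ c
    colour {_ ∷ _ ∷ []} p refl = AllPairs-⊆ ps p

  transitive⇒homogeneous : ∀ χ n xs → TransitiveOn χ xs → suc n * suc n ≤ length xs →
    HasHomogeneous χ 2 (suc n) xs
  transitive⇒homogeneous χ n xs tr le with Patience.patience χ (suc n) xs tr
  -- Here `zs` has `suc n` elements, so the chain has one more than required.
  ... | inj₂ (y , zs , p , l , ch) = y ∷ zs , p , m≤n⇒m≤1+n (≤-reflexive (sym l)) , 
          pairs-homogeneous χ true ch
  ... | inj₁ (B ∷ bs , refl , t , b)
    with Bs , p , q , n≤ ← Patience.large-bucket χ (suc n) B bs b (subst (suc n * suc n ≤_) (sym t) le)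
    = Bs , p , n≤ , pairs-homogeneous χ false (AllPairs.map Bool.¬-not q)

  -- The Plücker relation gives transitivity on `ys` once an earlier point `r` sees `ys` with one
  -- sign.
  LocallyTransitive : (List A → Bool) → List A → Set a
  LocallyTransitive χ xs = ∀ {r ys} → r ∷ ys ⊆ xs → Constant (λ i → χ (r ∷ i ∷ [])) ys → TransitiveOn χ ys

  -- One halving makes the sign constant; the strict inequality pays for `r`.
  locallyTransitive⇒homogeneous : ∀ χ n xs → LocallyTransitive χ xs →
    2 * (suc n * suc n) < length xs → HasHomogeneous χ 2 (suc n) xs
  locallyTransitive⇒homogeneous χ n (r ∷ xs) lt le
    with ys , p , le′ , const ← halve (λ i → χ (r ∷ i ∷ [])) xs (suc n * suc n) (≤-pred le)
    with zs , q , n≤ , h ← transitive⇒homogeneous χ n ys (lt (refl ∷ p) const) le′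
    = zs , ⊆-trans q (r ∷ʳ p) , n≤ , h

  TransitiveLinks : ℕ → (List A → Bool) → List A → Set a
  TransitiveLinks zero    χ xs = LocallyTransitive χ xs
  TransitiveLinks (suc i) χ xs = ∀ {q S} → q ∷ S ⊆ xs → TransitiveLinks i (χ ∘ (q ∷_)) S

-- Tower estimates and the iterated Ramsey bound.

m<2^m : ∀ m → m < 2 ^ m
m<2^m zero    = s≤s z≤n
m<2^m (suc m) = begin
  suc (suc m)      ≤⟨ s≤s (m<2^m m) ⟩
  1 + 2 ^ m        ≤⟨ +-monoˡ-≤ (2 ^ m) (m^n>0 2 m) ⟩
  2 ^ m + 2 ^ m    ≡⟨ cong (2 ^ m +_) (+-identityʳ _) ⟨
  2 ^ suc m        ∎
  where open ≤-Reasoning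

m*n≤m^n : ∀ {m} n → 2 ≤ m → m * suc n ≤ m ^ suc n
m*n≤m^n {m} n 2≤m = *-monoʳ-≤ m (≤-trans (m<2^m n) (^-monoˡ-≤ n 2≤m))

2≤twr : ∀ i {x} → 2 ≤ x → 2 ≤ twr (suc i) x
2≤twr zero    2≤x = 2≤x
2≤twr (suc i) 2≤x = ^-monoʳ-≤ 2 (≤-trans (n≤1+n 1) (2≤twr i 2≤x))

-- An exponent moves up the tower because `y * suc e` is at most `y ^ suc e` for `y` at least 2.
twr-^ : ∀ i {x} e → 2 ≤ x → twr (suc i) x ^ suc e ≤ twr (suc i) (x ^ suc e)
twr-^ zero        e 2≤x = ≤-refl
twr-^ (suc i) {x} e 2≤x = begin
  (2 ^ y) ^ suc e            ≡⟨ ^-*-assoc 2 y (suc e) ⟩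
  2 ^ (y * suc e)            ≤⟨ ^-monoʳ-≤ 2 (m*n≤m^n e (2≤twr i 2≤x)) ⟩
  2 ^ (y ^ suc e)            ≤⟨ ^-monoʳ-≤ 2 (twr-^ i e 2≤x) ⟩
  2 ^ twr (suc i) (x ^ suc e) ∎
  where
  open ≤-Reasoning
  y : ℕ
  y = twr (suc i) x

M*1+M^k≤M^2+k : ∀ {M} k → 2 ≤ M → M * suc (M ^ k) ≤ M ^ (2 + k)
M*1+M^k≤M^2+k {M} k 2≤M = *-monoʳ-≤ M (begin
  1 + M ^ k      ≤⟨ +-monoˡ-≤ (M ^ k) (≤-trans (m^n>0 2 k) (^-monoˡ-≤ k 2≤M)) ⟩
  M ^ k + M ^ k  ≡⟨ cong (M ^ k +_) (+-identityʳ _) ⟨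
  2 * M ^ k      ≤⟨ *-monoˡ-≤ (M ^ k) 2≤M ⟩
  M * M ^ k      ∎)
  where open ≤-Reasoning

2n²<n⁴ : ∀ {n} → 2 ≤ n → 2 * (n * n) < n ^ 4
2n²<n⁴ {n} 2≤n = begin-strict
  2 * (n * n)          <⟨ *-monoˡ-< (n * n) {{>-nonZero (≤-trans (s≤s z≤n) 4≤n*n)}} {2} {4} (s≤s (s≤s (s≤s z≤n))) ⟩
  4 * (n * n)          ≤⟨ *-monoˡ-≤ (n * n) 4≤n*n ⟩
  n * n * (n * n)      ≡⟨ *-assoc n n (n * n) ⟩
  n * (n * (n * n))    ≡⟨ cong (λ m → n * (n * (n * m))) (*-identityʳ n) ⟨
  n ^ 4                ∎
  where
  open ≤-Reasoning
  4≤n*n : 4 ≤ n * n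
  4≤n*n = *-mono-≤ 2≤n 2≤n

module _ {a} {A : Set a} where
  open Colouring A

  -- Pairs need 2n² + 1 ≤ n⁴ points.  The step from uniformity k to k + 1 replaces M by 2^(M (1 + M^k)),
  -- where M (1 + M^k) ≤ M^(k + 2) ≤ M^(e + 1).
  ramsey : ∀ {n e} i χ xs → 2 ≤ n → i + 3 ≤ suc e → twr (suc i) (n ^ (4 * suc e ^ i)) ≤ length xs →
    TransitiveLinks i χ xs → HasHomogeneous χ (2 + i) n xs
  ramsey {n@(suc _)}     zero    χ xs 2≤n i≤ le links =
    locallyTransitive⇒homogeneous χ _ xs links (≤-trans (2n²<n⁴ 2≤n) le)
  ramsey {n} {e} (suc i) χ xs 2≤n i≤ le links =
    erdős-rado (suc i) χ M n xs (begin
      2 ^ (M * suc (M ^ (2 + i)))  ≤⟨ ^-monoʳ-≤ 2 (M*1+M^k≤M^2+k (2 + i) 2≤M) ⟩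
      -- One `e` serves every level of the recursion, so the exponent of `n` gains a factor `suc e`
      -- each time.
      2 ^ (M ^ (4 + i))            ≤⟨ ^-monoʳ-≤ 2 (^-monoʳ-≤ M {{>-nonZero (≤-trans (s≤s z≤n) 2≤M)}}
                                        (subst (_≤ suc e) (cong suc (+-comm i 3)) i≤)) ⟩
      2 ^ (M ^ suc e)              ≤⟨ ^-monoʳ-≤ 2 (twr-^ i e 2≤x) ⟩
      2 ^ twr (suc i) (x ^ suc e)  ≡⟨ cong (λ m → 2 ^ twr (suc i) m) x^e ⟩
      twr (2 + i) (n ^ (4 * suc e ^ suc i)) ≤⟨ le ⟩
      length xs                    ∎)
      (λ p M≤ → ramsey i _ _ 2≤n (≤-trans (n≤1+n _) i≤) M≤ (links p))
    where
    open ≤-Reasoning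
    x M : ℕ
    x = n ^ (4 * suc e ^ i)
    M = twr (suc i) x
    2≤x : 2 ≤ x
    2≤x = ≤-trans 2≤n (≤-trans (≤-reflexive (sym (^-identityʳ n)))
      (^-monoʳ-≤ n {{>-nonZero (≤-trans (s≤s z≤n) 2≤n)}} (*-mono-≤ {1} {4} (s≤s z≤n) (m^n>0 (suc e) i))))
    2≤M : 2 ≤ M
    2≤M = 2≤twr i 2≤x
    x^e : x ^ suc e ≡ n ^ (4 * suc e ^ suc i)
    x^e = trans (^-*-assoc n (4 * suc e ^ i) (suc e))
      (cong (n ^_) (trans (*-assoc 4 (suc e ^ i) (suc e)) (cong (4 *_) (*-comm (suc e ^ i) (suc e)))))

-- Sorted lists and increasing index maps.

AllPairs-resp-⊆ : ∀ {a r} {A : Set a} {R : A → A → Set r} {xs ys} → xs ⊆ ys → AllPairs R ys → AllPairs R xs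
AllPairs-resp-⊆ []         []       = []
AllPairs-resp-⊆ (y ∷ʳ p)   (_ ∷ rs) = AllPairs-resp-⊆ p rs
AllPairs-resp-⊆ (refl ∷ p) (r ∷ rs) = All-resp-⊆ p r ∷ AllPairs-resp-⊆ p rs

AllPairs-tabulate⁻ : ∀ {a r} {A : Set a} {R : A → A → Set r} {n} {f : Fin n → A} →
  AllPairs R (tabulate f) → ∀ {i j} → i <ᶠ j → R (f i) (f j)
AllPairs-tabulate⁻ (r ∷ rs) {zero}  {suc j} _         = All.tabulate⁻ r j
AllPairs-tabulate⁻ (r ∷ rs) {suc i} {suc j} (s≤s i<j) = AllPairs-tabulate⁻ rs i<j

-- For sorted lists membership decides the sublist relation, so increasing index maps can be read as
-- sublists.
sorted-⊆ : ∀ {N} {zs ys : List (Fin N)} → AllPairs _<ᶠ_ zs → AllPairs _<ᶠ_ ys → All (_∈ ys) zs → zs ⊆ ys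
sorted-⊆ {ys = ys} [] _ _ = minimum ys
sorted-⊆ {N} {ys = y ∷ ys} (z<zs ∷ s) (y<ys ∷ t) (z∈ ∷ zs∈) = place z∈
  where
  ∈-tail : ∀ {w} → y <ᶠ w → w ∈ y ∷ ys → w ∈ ys
  ∈-tail y<w (here refl) = ⊥-elim (Fin.<-irrefl refl y<w)
  ∈-tail y<w (there w∈)  = w∈
  place : _ ∈ y ∷ ys → _ ⊆ y ∷ ys
  place (here refl)  = refl ∷ sorted-⊆ s t (All.zipWith (λ (y<w , w∈) → ∈-tail y<w w∈) (z<zs , zs∈))
  place (there z∈ys) = y ∷ʳ sorted-⊆ (z<zs ∷ s) t
    (z∈ys ∷ All.zipWith (λ (z<w , w∈) → ∈-tail (Fin.<-trans (All.lookup y<ys z∈ys) z<w) w∈) (z<zs , zs∈))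

≡-tabulate : ∀ {a} {A : Set a} (xs : List A) {n} → length xs ≡ n → ∃ λ (f : Fin n → A) → xs ≡ tabulate f
≡-tabulate xs refl = nth xs , sym (tabulate-lookup xs)

-- Orientation as a colouring with transitive links.

module Orientation {a ℓ} (F : OrderedField a ℓ) {d N} (P : Fin N → Point F d) (gp : GeneralPosition F P) where
  open OrderedField F using (commRing; <-resp-≈)
  open CommutativeRing commRing using (_≈_; 0#) renaming (refl to ≈-refl; sym to ≈-sym; trans to ≈-trans)
  open OrderedFieldProperties F
  open Wedge commRing (Fin N)
  open Plücker p≈-p⇒p≈0
  open DetWedge F (Fin N)
  open Colouring (Fin N)

  -- Row `i` of the orientation matrix as a functional on indices. A column depends only on its own
  -- point, so a constant tuple serves.
  coordinate : Fin (suc d) → Fin N → OrderedField.Carrier F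
  coordinate i x = orientMatrix F d (λ _ → P x) i zero

  Ω : Form
  Ω = ⋀ (tabulate coordinate)

  orientDet≈Ω : ∀ g → orientDet F P g ≈ Ω (tabulate g)
  orientDet≈Ω = det≈⋀ (suc d) coordinate

  sorted : AllPairs _<ᶠ_ (allFin N)
  sorted = tabulate⁺-< id

  strictlyIncreasing : ∀ {n} {f : Fin n → Fin N} → tabulate f ⊆ allFin N → StrictlyIncreasing F f
  strictlyIncreasing p = AllPairs-tabulate⁻ (AllPairs-resp-⊆ p sorted)

  Ω≉0 : ∀ {zs} → zs ⊆ allFin N → length zs ≡ suc d → ¬ Ω zs ≈ 0#
  Ω≉0 {zs} p e Ω≈0 with g , refl ← ≡-tabulate zs e =
    gp g (strictlyIncreasing p) (≈-trans (orientDet≈Ω g) Ω≈0)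

  χ : List (Fin N) → Bool
  χ = positive? ∘ Ω

  -- `qs` holds the fixed points, latest first, so `qs ʳ++ xs` is in index order. Once `d - 1`
  -- points are fixed, the Plücker relation applies.
  transitive-links : ∀ i qs {xs} → qs ʳ++ xs ⊆ allFin N → length qs + (2 + i) ≡ suc d →
    TransitiveLinks i (χ ∘ (qs ʳ++_)) xs
  transitive-links (suc i) qs p e {q} q∷S⊆xs =
    transitive-links i (q ∷ qs) (⊆-trans (ʳ++⁺ (⊆-refl {x = qs}) q∷S⊆xs) p)
      (trans (sym (+-suc (length qs) (2 + i))) e)
  transitive-links zero qs {xs} p e {r} {ys} r∷ys⊆xs (true , c) {i} {j} {k} i∈ j∈ k∈ ij jk =
    true-positive? (combination-pos (pos i∈) (pos j∈) (pos k∈) (positive?-true jk) (positive?-true ij)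
      (plücker (tabulate coordinate) qs r i j k))
    where
    pos : ∀ {y} → y ∈ ys → OrderedField._<ᶠ′_ F 0# (Ω (qs ʳ++ (r ∷ y ∷ [])))
    pos y∈ = positive?-true (c y∈)
  -- The brackets with `r` are negative here; negating the relation makes its coefficients positive.
  transitive-links zero qs {xs} p e {r} {ys} r∷ys⊆xs (false , c) {i} {j} {k} i∈ j∈ k∈ ij jk =
    true-positive? (combination-pos (pos i∈) (pos j∈) (pos k∈) (positive?-true jk) (positive?-true ij)
      (negate-combination (plücker (tabulate coordinate) qs r i j k)))
    where
    pos : ∀ {y} → y ∈ ys → OrderedField._<ᶠ′_ F 0# (OrderedField.-_ F (Ω (qs ʳ++ (r ∷ y ∷ []))))
    pos y∈ = neg⇒pos (positive?-false
      (Ω≉0 (⊆-trans (ʳ++⁺ (⊆-refl {x = qs}) (⊆-trans (refl ∷ from∈ y∈) r∷ys⊆xs)) p) (trans (length-ʳ++ qs) e))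
      (c y∈))

  homogeneous⇒monotone : ∀ {n} → HasHomogeneous χ (suc d) n (allFin N) → HasMonotoneSubset F n P
  homogeneous⇒monotone {n} (ys , ys⊆ , n≤ , c , h)
    -- The homogeneous list may exceed `n`; its first `n` entries give the index map.
    with f , eq ← ≡-tabulate (take n ys) (trans (length-take n ys) (m≤n⇒m⊓n≡m n≤))
    = f , f-increasing , orientation c refl
    where
    f⊆ys : tabulate f ⊆ ys
    f⊆ys = subst (_⊆ ys) eq (take-⊆ n ys)
    f-increasing : StrictlyIncreasing F f
    f-increasing = strictlyIncreasing (⊆-trans f⊆ys ys⊆)
    colour : ∀ (g : Fin (suc d) → Fin n) → StrictlyIncreasing F g → χ (tabulate (f ∘ g)) ≡ c
    colour g g-increasing = h (⊆-trans
      (sorted-⊆ (tabulate⁺-< (f-increasing ∘ g-increasing)) (tabulate⁺-< f-increasing)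
        (All.tabulate⁺ (∈-tabulate⁺ ∘ g))) f⊆ys) (length-tabulate (f ∘ g))
    orientation : ∀ c′ → c ≡ c′ →
      (∀ (g : Fin (suc d) → Fin n) → StrictlyIncreasing F g → PositiveOrientation F P (f ∘ g)) ⊎
      (∀ (g : Fin (suc d) → Fin n) → StrictlyIncreasing F g → NegativeOrientation F P (f ∘ g))
    orientation true  refl = inj₁ λ g inc →
      <-resp-≈ ≈-refl (≈-sym (orientDet≈Ω (f ∘ g))) (positive?-true (colour g inc))
    orientation false refl = inj₂ λ g inc →
      <-resp-≈ (≈-sym (orientDet≈Ω (f ∘ g))) ≈-refl
        (positive?-false (gp (f ∘ g) (f-increasing ∘ inc) ∘ ≈-trans (orientDet≈Ω (f ∘ g))) (colour g inc))

1≤twr : ∀ i {x} → 1 ≤ x → 1 ≤ twr (suc i) x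
1≤twr zero    1≤x = 1≤x
1≤twr (suc i) 1≤x = m^n>0 2 (twr (suc i) _)

-- A tuple has at least two indices, so the orientation condition is vacuous. This covers the values
-- of `n` outside the range `2 ≤ n` of the tower estimates.
OTProperty-≤1 : ∀ {a ℓ} (F : OrderedField a ℓ) d n → n ≤ 1 → OTProperty F (suc d) n n
OTProperty-≤1 F d n n≤1 P gp =
  id , id , inj₁ λ g inc → ⊥-elim (impossible n≤1 (g zero) (g (suc zero)) (inc (s≤s z≤n)))
  where
  impossible : ∀ {n} → n ≤ 1 → (i j : Fin n) → ¬ i <ᶠ j
  impossible (s≤s z≤n) zero zero ()

theorem3 : ∀ {a ℓ : Level} (d : ℕ) → 3 ≤ d →
    Σ ℕ λ c → ∀ (F : OrderedField a ℓ) (n : ℕ) → OT≤ F d n (twr d (n ^ c))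
theorem3 {a} {ℓ} (suc d) _ = c , bound
  where
  c : ℕ
  -- The dimension is `suc d`; `ramsey` is run with `i = d` and the least admissible `suc e`, namely
  -- `3 + d`.
  c = 4 * (3 + d) ^ d
  bound : ∀ (F : OrderedField a ℓ) (n : ℕ) → OT≤ F (suc d) n (twr (suc d) (n ^ c))
  bound F 0 = 0 , z≤n , OTProperty-≤1 F d 0 z≤n
  bound F 1 = 1 , 1≤twr d (m^n>0 1 c) , OTProperty-≤1 F d 1 ≤-refl
  bound F n@(suc (suc _)) = N , ≤-refl , λ P gp →
    let open Orientation F P gp in
    homogeneous⇒monotone (ramsey d χ (allFin N) (s≤s (s≤s z≤n)) (≤-reflexive (+-comm d 3))
      (≤-reflexive (sym (length-tabulate {n = N} id))) (transitive-links d [] ⊆-refl refl))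
    where
    N : ℕ
    N = twr (suc d) (n ^ c)
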